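{- Let $G=(V,E)$ be a connected graph and $(A,B)$ a split of $G$, let $C=N_G(B)\subseteq A$ and $D=N_G(A)\subseteq B$, let $a\in C$, $b\in D$, and let $G_A=G[A\cup\{b\}]$, $G_B=G[B\cup\{a\}]$. Then $\delta(G)=\max\{\delta(G_A),\delta(G_B),\delta^*\}$, where $\delta^*=1$ if neither $C$ nor $D$ is a clique; $\delta^*=1/2$ if $\min\{|C|,|D|\}\ge2$ and exactly one of $C$, $D$ is a clique; and $\delta^*=0$ otherwise.
   Context: A split of a connected graph $G$ is a bipartition $(A,B)$ of $V$ with $\min\{|A|,|B|\}\ge2$ such that every vertex of $N_G(A)$ is adjacent to every vertex of $N_G(B)$. For a graph $H$, $\delta(H)=\max_{u,v,x,y\in V(H)}\frac{S_1-\max\{S_2,S_3\}}{2}$ with $S_1=dist_H(u,v)+dist_H(x,y)$, $S_2=dist_H(u,x)+dist_H(v,y)$, $S_3=dist_H(u,y)+dist_H(v,x)$. -}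

module Defs where

open import Data.Nat using (ℕ; zero; suc; _≤_)
open import Data.Bool using (Bool; true; false; _∧_; _∨_; not; if_then_else_)
open import Data.Fin using (Fin)
open import Data.Fin.Properties using (_≟_)
open import Data.List using (List; allFin; foldr; length; filter)
open import Data.Bool.ListAction using (any; all)
open import Data.Integer using (ℤ; +_; _-_; _⊔_)
open import Data.Product using (Σ; _×_)
open import Relation.Nullary.Decidable using (⌊_⌋)
open import Relation.Binary.PropositionalEquality using (_≡_)
open import Function using (_∘_)

record Graph (n : ℕ) : Set where
  field
    adj    : Fin n → Fin n → Bool
    sym    : ∀ u v → adj u v ≡ adj v u
    irrefl : ∀ u → adj u u ≡ false
open Graph public

VSet : ℕ → Set
VSet n = Fin n → Bool

full : ∀ {n} → VSet n
full _ = true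

_==_ : ∀ {n} → Fin n → Fin n → Bool
u == v = ⌊ u ≟ v ⌋

anyV : ∀ {n} → (Fin n → Bool) → Bool
anyV {n} p = any p (allFin n)

allV : ∀ {n} → (Fin n → Bool) → Bool
allV {n} p = all p (allFin n)

-- reach G S k u v = true iff there is a walk of length ≤ k from u to v
-- in the induced subgraph G[S] (all vertices of the walk lie in S).
reach : ∀ {n} → Graph n → VSet n → ℕ → Fin n → Fin n → Bool
reach G S zero    u v = S u ∧ (u == v)
reach G S (suc k) u v = reach G S k u v ∨ (S u ∧ anyV (λ w → adj G u w ∧ reach G S k w v))

-- least k < b with p k, or b if there is none
least : ℕ → (ℕ → Bool) → ℕ
least zero    p = zero
least (suc b) p = if p zero then zero else suc (least b (p ∘ suc))

-- distance in the induced subgraph G[S]: length of a shortest walk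
-- (any walk between connected vertices can be shortened to length < n).
dist : ∀ {n} → Graph n → VSet n → Fin n → Fin n → ℕ
dist {n} G S u v = least n (λ k → reach G S k u v)

Connected : ∀ {n} → Graph n → Set
Connected G = ∀ u v → Σ ℕ (λ k → reach G full k u v ≡ true)

-- The four-point quantity (S₁ - max{S₂,S₃}), i.e. twice the summand in δ.
fourPoint : ∀ {n} → Graph n → VSet n → Fin n → Fin n → Fin n → Fin n → ℤ
fourPoint G S u v x y =
  + (d u v Data.Nat.+ d x y) - (+ (d u x Data.Nat.+ d v y) ⊔ + (d u y Data.Nat.+ d v x))
  where d = dist G S

-- 2·δ(G[S]) = max over u,v,x,y ∈ S of (S₁ - max{S₂,S₃}).
-- The fold starts at 0, which is the value at u = v = x = y (S nonempty in use).
delta2 : ∀ {n} → Graph n → VSet n → ℤ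
delta2 {n} G S =
  foldr _⊔_ (+ 0)
    (Data.List.concatMap (λ u → Data.List.concatMap (λ v → Data.List.concatMap (λ x →
      Data.List.map (fourPoint G S u v x)
        (filter (λ y → Data.Bool.Properties.T? (S y)) (allFin n)))
      (filter (λ x → Data.Bool.Properties.T? (S x)) (allFin n)))
      (filter (λ v → Data.Bool.Properties.T? (S v)) (allFin n)))
      (filter (λ u → Data.Bool.Properties.T? (S u)) (allFin n)))
  where import Data.Bool.Properties

size : ∀ {n} → VSet n → ℕ
size {n} S = length (filter (λ v → Data.Bool.Properties.T? (S v)) (allFin n))
  where import Data.Bool.Properties

compl : ∀ {n} → VSet n → VSet n
compl A v = not (A v)

nbhd : ∀ {n} → Graph n → VSet n → VSet n
nbhd G X v = not (X v) ∧ anyV (λ w → X w ∧ adj G w v)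

IsSplit : ∀ {n} → Graph n → VSet n → Set
IsSplit G A =
  (2 ≤ size A) × (2 ≤ size (compl A)) ×
  (∀ c d → nbhd G (compl A) c ≡ true → nbhd G A d ≡ true → adj G c d ≡ true)

isClique : ∀ {n} → Graph n → VSet n → Bool
isClique G X = allV (λ u → allV (λ v → not (X u ∧ X v ∧ not (u == v)) ∨ adj G u v))

-- 2·δ*: 2 if neither C nor D is a clique; 1 if min{|C|,|D|} ≥ 2 and exactly
-- one of C, D is a clique; 0 otherwise.
deltaStar2 : ∀ {n} → Graph n → VSet n → VSet n → ℤ
deltaStar2 G C D with isClique G C | isClique G D
... | false | false = + 2
... | true  | true  = + 0
... | _     | _     with Data.Nat._≤ᵇ_ 2 (size C) ∧ Data.Nat._≤ᵇ_ 2 (size D)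
...   | true  = + 1
...   | false = + 0

module Submission where

-- The depth of u ∈ A is its G_A-distance to b minus one,
-- i.e. its distance to C.  The argument has three ingredients:
--   * G_A and G_B are isometric subgraphs of G, and for u ∈ A, x ∈ B
--     d(u,x) = 1 + depth u + depth x  (SplitSide);  so a four-point quantity
--     with at most one point in B is one of G_A, after moving that point to b;
--   * a quadruple with two points on each side has excess ≤ 0 if the sides
--     alternate, and ≤ 2δ* otherwise, by routing through C and D;
--   * conversely G_A, G_B embed isometrically and δ* is attained on C ∪ D.

open import Defs hiding (sym)
open import Data.Bool using (Bool; true; false; _∧_; _∨_; not; T; if_then_else_)
open import Data.Bool.Properties using (T-≡; T?; ∧-zeroʳ; not-involutive)
open import Data.Nat as ℕ using (ℕ; zero; suc; _+_; _∸_; _≤_; _<_; z≤n; s≤s; s≤s⁻¹; _≤ᵇ_)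
open import Data.Nat.Properties hiding (_≟_)
open import Data.Nat.Tactic.RingSolver using (solve-∀)
open import Data.Integer as ℤ using (ℤ; +_; _⊖_; _-_; _⊔_)
import Data.Integer.Properties as ℤP
open import Data.Fin using (Fin)
open import Data.Fin.Properties using () renaming (_≟_ to _≟ᶠ_)
open import Data.List using (List; []; _∷_; allFin; filter; length; map; concatMap; foldr)
open import Data.List.Membership.Propositional using (_∈_; find; lose)
open import Data.List.Membership.Propositional.Properties
  using (∈-allFin; ∈-filter⁺; ∈-filter⁻; ∈-map⁺; ∈-map⁻; ∈-concatMap⁺; ∈-concatMap⁻)
open import Data.List.Relation.Unary.Any using (here; there)
open import Data.List.Relation.Unary.Any.Properties using (any⁺; any⁻)
import Data.List.Relation.Unary.All as All
open import Data.List.Relation.Unary.All.Properties using (all⁺; all⁻; ¬All⇒Any¬)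
open import Data.List.Relation.Unary.AllPairs using (_∷_)
open import Data.List.Relation.Unary.Unique.Propositional using (Unique)
import Data.List.Relation.Unary.Unique.Propositional.Properties as Unique
open import Data.List.Properties using (length-filter; length-tabulate)
open import Data.Product using (Σ; _×_; _,_; proj₁; proj₂)
open import Data.Sum using (_⊎_; inj₁; inj₂)
open import Data.Empty using (⊥; ⊥-elim)
open import Function using (_∘_)
open import Function.Bundles using (Equivalence)
open import Relation.Nullary using (¬_; yes; no)
open import Relation.Nullary.Decidable using (isYes≗does; dec-true; dec-false; toWitness)
open import Relation.Binary.PropositionalEquality

T⇒≡ : ∀ {b} → T b → b ≡ true
T⇒≡ = Equivalence.to T-≡

≡⇒T : ∀ {b} → b ≡ true → T b
≡⇒T = Equivalence.from T-≡

true≢false : ∀ {b} → b ≡ true → b ≡ false → ⊥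
true≢false refl ()

∨-true⁻ : ∀ {x y} → x ∨ y ≡ true → x ≡ true ⊎ y ≡ true
∨-true⁻ {true}  _ = inj₁ refl
∨-true⁻ {false} e = inj₂ e

∨-trueˡ : ∀ {x} y → x ≡ true → x ∨ y ≡ true
∨-trueˡ y refl = refl

∨-trueʳ : ∀ x {y} → y ≡ true → x ∨ y ≡ true
∨-trueʳ true  _ = refl
∨-trueʳ false e = e

∧-true⁻ : ∀ {x y} → x ∧ y ≡ true → x ≡ true × y ≡ true
∧-true⁻ {true} e = refl , e

∧-true⁺ : ∀ {x y} → x ≡ true → y ≡ true → x ∧ y ≡ true
∧-true⁺ refl e = e

not-true⁻ : ∀ {x} → not x ≡ true → x ≡ false
not-true⁻ {false} _ = refl

implication-false⁻ : ∀ {x y} → not x ∨ y ≡ false → x ≡ true × y ≡ false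
implication-false⁻ {true} {false} _ = refl , refl

bool-ext : ∀ {x y : Bool} → (x ≡ true → y ≡ true) → (y ≡ true → x ≡ true) → x ≡ y
bool-ext {true}  f g = sym (f refl)
bool-ext {false} {true}  f g = g refl
bool-ext {false} {false} f g = refl

anyV⁻ : ∀ {n} (p : Fin n → Bool) → anyV p ≡ true → Σ (Fin n) λ x → p x ≡ true
anyV⁻ {n} p e with find (any⁻ p (allFin n) (≡⇒T e))
... | x , _ , px = x , T⇒≡ px

anyV⁺ : ∀ {n} (p : Fin n → Bool) x → p x ≡ true → anyV p ≡ true
anyV⁺ p x px = T⇒≡ (any⁺ p (lose (∈-allFin x) (≡⇒T px)))

allV⁻ : ∀ {n} (p : Fin n → Bool) → allV p ≡ true → ∀ x → p x ≡ true
allV⁻ {n} p e x = T⇒≡ (All.lookup (all⁺ p (allFin n) (≡⇒T e)) (∈-allFin x))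

allV-false⁻ : ∀ {n} (p : Fin n → Bool) → allV p ≡ false → Σ (Fin n) λ x → p x ≡ false
allV-false⁻ {n} p e with find (¬All⇒Any¬ (T? ∘ p) (allFin n) (λ ps → true≢false (T⇒≡ (all⁻ p ps)) e))
... | x , _ , ¬px with p x in px
...   | true  = ⊥-elim (¬px _)
...   | false = x , px

==-refl : ∀ {n} (u : Fin n) → u == u ≡ true
==-refl u = trans (isYes≗does (u ≟ᶠ u)) (dec-true (u ≟ᶠ u) refl)

==-true⁻ : ∀ {n} {u v : Fin n} → u == v ≡ true → u ≡ v
==-true⁻ e = toWitness (≡⇒T e)

==-false : ∀ {n} {u v : Fin n} → ¬ u ≡ v → u == v ≡ false
==-false {u = u} {v} u≢v = trans (isYes≗does (u ≟ᶠ v)) (dec-false (u ≟ᶠ v) u≢v)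

module Walks {n : ℕ} (G : Graph n) where

  reach-source : ∀ S k {u v} → reach G S k u v ≡ true → S u ≡ true
  reach-source S zero    r = proj₁ (∧-true⁻ r)
  reach-source S (suc k) {u} {v} r with ∨-true⁻ {reach G S k u v} r
  ... | inj₁ r′ = reach-source S k r′
  ... | inj₂ r′ = proj₁ (∧-true⁻ r′)

  reach-zero⁻ : ∀ S {u v} → reach G S 0 u v ≡ true → u ≡ v
  reach-zero⁻ S r = ==-true⁻ (proj₂ (∧-true⁻ r))

  reach-suc⁻ : ∀ S k {u v} → reach G S (suc k) u v ≡ true →
    reach G S k u v ≡ true ⊎ Σ (Fin n) λ w → adj G u w ≡ true × reach G S k w v ≡ true
  reach-suc⁻ S k {u} {v} r with ∨-true⁻ {reach G S k u v} r
  ... | inj₁ r′ = inj₁ r′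
  ... | inj₂ r′ with anyV⁻ (λ w → adj G u w ∧ reach G S k w v) (proj₂ (∧-true⁻ r′))
  ...   | w , e = inj₂ (w , ∧-true⁻ e)

  reach-target : ∀ S k {u v} → reach G S k u v ≡ true → S v ≡ true
  reach-target S zero r with reach-zero⁻ S r
  ... | refl = proj₁ (∧-true⁻ r)
  reach-target S (suc k) r with reach-suc⁻ S k r
  ... | inj₁ r′          = reach-target S k r′
  ... | inj₂ (_ , _ , r′) = reach-target S k r′

  reach-refl : ∀ S {u} → S u ≡ true → reach G S 0 u u ≡ true
  reach-refl S {u} su = ∧-true⁺ su (==-refl u)

  reach-weaken : ∀ S k {u v} → reach G S k u v ≡ true → reach G S (suc k) u v ≡ true
  reach-weaken S k r = ∨-trueˡ _ r

  reach-mono : ∀ S {j k} → j ≤ k → ∀ {u v} → reach G S j u v ≡ true → reach G S k u v ≡ true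
  reach-mono S {j} {k} j≤k {u} {v} r =
    subst (λ m → reach G S m u v ≡ true) (m+[n∸m]≡n j≤k) (go (k ∸ j))
    where
      go : ∀ i → reach G S (j + i) u v ≡ true
      go zero    = subst (λ m → reach G S m u v ≡ true) (sym (+-identityʳ j)) r
      go (suc i) = subst (λ m → reach G S m u v ≡ true) (sym (+-suc j i)) (reach-weaken S (j + i) (go i))

  reach-cons : ∀ S k {u w v} → S u ≡ true → adj G u w ≡ true → reach G S k w v ≡ true →
    reach G S (suc k) u v ≡ true
  reach-cons S k {u} {w} {v} su uw r =
    ∨-trueʳ (reach G S k u v) (∧-true⁺ su (anyV⁺ (λ x → adj G u x ∧ reach G S k x v) w (∧-true⁺ uw r)))

  reach-edge : ∀ S {u v} → S u ≡ true → S v ≡ true → adj G u v ≡ true → reach G S 1 u v ≡ true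
  reach-edge S su sv uv = reach-cons S 0 su uv (reach-refl S sv)

  reach-++ : ∀ S j k {u w v} → reach G S j u w ≡ true → reach G S k w v ≡ true →
    reach G S (j + k) u v ≡ true
  reach-++ S zero k r₁ r₂ with reach-zero⁻ S r₁
  ... | refl = r₂
  reach-++ S (suc j) k r₁ r₂ with reach-suc⁻ S j r₁
  ... | inj₁ r  = reach-weaken S (j + k) (reach-++ S j k r r₂)
  ... | inj₂ (_ , e , r) = reach-cons S (j + k) (reach-source S (suc j) r₁) e (reach-++ S j k r r₂)

  reach-sym : ∀ S k {u v} → reach G S k u v ≡ true → reach G S k v u ≡ true
  reach-sym S zero r with reach-zero⁻ S r
  ... | refl = r
  reach-sym S (suc k) {u} {v} r with reach-suc⁻ S k r
  ... | inj₁ r′ = reach-weaken S k (reach-sym S k r′)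
  ... | inj₂ (w , e , r′) =
    subst (λ m → reach G S m v u ≡ true) (+-comm k 1)
      (reach-++ S k 1 (reach-sym S k r′)
        (reach-edge S (reach-source S k r′) (reach-source S (suc k) r) (trans (Graph.sym G w u) e)))

  reach-⊆ : ∀ S T → (∀ x → S x ≡ true → T x ≡ true) → ∀ k {u v} →
    reach G S k u v ≡ true → reach G T k u v ≡ true
  reach-⊆ S T S⊆T zero r = ∧-true⁺ (S⊆T _ (proj₁ (∧-true⁻ r))) (proj₂ (∧-true⁻ r))
  reach-⊆ S T S⊆T (suc k) r with reach-suc⁻ S k r
  ... | inj₁ r′ = reach-weaken T k (reach-⊆ S T S⊆T k r′)
  ... | inj₂ (_ , e , r′) = reach-cons T k (S⊆T _ (reach-source S (suc k) r)) e (reach-⊆ S T S⊆T k r′)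

  reach-full : ∀ S k {u v} → reach G S k u v ≡ true → reach G full k u v ≡ true
  reach-full S = reach-⊆ S full (λ _ _ → refl)

  reach-one⁻ : ∀ S {u v} → reach G S 1 u v ≡ true → u ≡ v ⊎ adj G u v ≡ true
  reach-one⁻ S r with reach-suc⁻ S 0 r
  ... | inj₁ r′ = inj₁ (reach-zero⁻ S r′)
  ... | inj₂ (_ , e , r′) with reach-zero⁻ S r′
  ...   | refl = inj₂ e

  first-edge : ∀ S k {u v} → reach G S k u v ≡ true → ¬ u ≡ v →
    Σ ℕ λ k′ → Σ (Fin n) λ w → k ≡ suc k′ × adj G u w ≡ true × reach G S k′ w v ≡ true
  first-edge S zero r u≢v = ⊥-elim (u≢v (reach-zero⁻ S r))
  first-edge S (suc k) r u≢v with reach-suc⁻ S k r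
  ... | inj₂ (w , e , r′) = k , w , refl , e , r′
  ... | inj₁ r′ with first-edge S k r′ u≢v
  ...   | k′ , w , refl , e , r″ = k , w , refl , e , reach-weaken S k′ r″

least-minimal : ∀ b (p : ℕ → Bool) k → p k ≡ true → least b p ≤ k
least-minimal zero    p k pk = z≤n
least-minimal (suc b) p k pk with p zero in p0
... | true = z≤n
least-minimal (suc b) p zero    pk | false = ⊥-elim (true≢false pk p0)
least-minimal (suc b) p (suc k) pk | false = s≤s (least-minimal b (p ∘ suc) k pk)

least-≤ : ∀ b (p : ℕ → Bool) → least b p ≤ b
least-≤ zero    p = z≤n
least-≤ (suc b) p with p zero
... | true  = z≤n
... | false = s≤s (least-≤ b (p ∘ suc))

least-spec : ∀ b (p : ℕ → Bool) → p (least b p) ≡ true ⊎ least b p ≡ b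
least-spec zero    p = inj₂ refl
least-spec (suc b) p with p zero in p0
... | true = inj₁ p0
... | false with least-spec b (p ∘ suc)
...   | inj₁ h = inj₁ h
...   | inj₂ h = inj₂ (cong suc h)

least-cong : ∀ b (p q : ℕ → Bool) → (∀ k → p k ≡ q k) → least b p ≡ least b q
least-cong zero    p q p≗q = refl
least-cong (suc b) p q p≗q rewrite p≗q zero =
  cong (λ m → if q zero then zero else suc m) (least-cong b (p ∘ suc) (q ∘ suc) (p≗q ∘ suc))

least-pos : ∀ b (p : ℕ → Bool) → 1 ≤ b → p zero ≡ false → 1 ≤ least b p
least-pos (suc b) p _ p0 rewrite p0 = s≤s z≤n

module Distance {n : ℕ} (G : Graph n) (S : VSet n) where
  open Walks G

  d : Fin n → Fin n → ℕ
  d = dist G S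

  dist-minimal : ∀ k {u v} → reach G S k u v ≡ true → d u v ≤ k
  dist-minimal k {u} {v} = least-minimal n (λ k → reach G S k u v) k

  dist-≤n : ∀ u v → d u v ≤ n
  dist-≤n u v = least-≤ n (λ k → reach G S k u v)

  dist-spec : ∀ u v → reach G S (d u v) u v ≡ true ⊎ d u v ≡ n
  dist-spec u v = least-spec n (λ k → reach G S k u v)

  dist-realised : ∀ u v → d u v < n → reach G S (d u v) u v ≡ true
  dist-realised u v d<n with dist-spec u v
  ... | inj₁ r = r
  ... | inj₂ e = ⊥-elim (<-irrefl e d<n)

  dist-sym : ∀ u v → d u v ≡ d v u
  dist-sym u v = least-cong n _ _ (λ k → bool-ext (reach-sym S k) (reach-sym S k))

  dist-self : ∀ u → S u ≡ true → d u u ≡ 0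
  dist-self u su = n≤0⇒n≡0 (dist-minimal 0 (reach-refl S su))

  dist-pos : ∀ {u v} → ¬ u ≡ v → 1 ≤ d u v
  dist-pos {u} {v} u≢v = least-pos n (λ k → reach G S k u v) (nonempty u)
    (trans (cong (S u ∧_) (==-false u≢v)) (∧-zeroʳ (S u)))
    where
      nonempty : Fin n → 1 ≤ n
      nonempty Fin.zero    = s≤s z≤n
      nonempty (Fin.suc _) = s≤s z≤n

  dist-edge : ∀ {z w} t → S z ≡ true → adj G z w ≡ true → d z t ≤ suc (d w t)
  dist-edge {z} {w} t sz zw with dist-spec w t
  ... | inj₁ r = dist-minimal _ (reach-cons S (d w t) sz zw r)
  ... | inj₂ e = ≤-trans (dist-≤n z t) (subst (λ m → n ≤ suc m) (sym e) (n≤1+n n))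

  -- the triangle inequality, also valid for the default value n
  dist-triangle : ∀ u v w → d u w ≤ d u v + d v w
  dist-triangle u v w with dist-spec u v | dist-spec v w
  ... | inj₁ r₁ | inj₁ r₂ = dist-minimal _ (reach-++ S (d u v) (d v w) r₁ r₂)
  ... | inj₂ e  | _       = ≤-trans (dist-≤n u w) (subst (λ m → n ≤ m + d v w) (sym e) (m≤m+n n _))
  ... | inj₁ _  | inj₂ e  = ≤-trans (dist-≤n u w) (subst (λ m → n ≤ d u v + m) (sym e) (m≤n+m n _))

dist-⊆ : ∀ {n} (G : Graph n) S T → (∀ x → S x ≡ true → T x ≡ true) → ∀ u v →
  dist G T u v ≤ dist G S u v
dist-⊆ G S T S⊆T u v with Distance.dist-spec G S u v
... | inj₁ r = Distance.dist-minimal G T _ (Walks.reach-⊆ G S T S⊆T (dist G S u v) {u} {v} r)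
... | inj₂ e = ≤-trans (Distance.dist-≤n G T u v) (≤-reflexive (sym e))

count : ∀ {n} → VSet n → List (Fin n) → ℕ
count X xs = length (filter (λ v → T? (X v)) xs)

count-mono : ∀ {n} (X Y : VSet n) → (∀ u → X u ≡ true → Y u ≡ true) → ∀ xs → count X xs ≤ count Y xs
count-mono X Y X⊆Y [] = z≤n
count-mono X Y X⊆Y (x ∷ xs) with X x in xx | Y x in yx
... | true  | true  = s≤s (count-mono X Y X⊆Y xs)
... | true  | false = ⊥-elim (true≢false (X⊆Y x xx) yx)
... | false | true  = m≤n⇒m≤1+n (count-mono X Y X⊆Y xs)
... | false | false = count-mono X Y X⊆Y xs

count-strict : ∀ {n} (X Y : VSet n) → (∀ u → X u ≡ true → Y u ≡ true) → ∀ {u} xs → u ∈ xs →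
  Y u ≡ true → X u ≡ false → suc (count X xs) ≤ count Y xs
count-strict X Y X⊆Y (x ∷ xs) u∈xs yu xu with X x in xx | Y x in yx | u∈xs
... | true  | false | _ = ⊥-elim (true≢false (X⊆Y x xx) yx)
... | true  | true  | here refl = ⊥-elim (true≢false xx xu)
... | true  | true  | there u∈ = s≤s (count-strict X Y X⊆Y xs u∈ yu xu)
... | false | true  | here refl = s≤s (count-mono X Y X⊆Y xs)
... | false | true  | there u∈ = m≤n⇒m≤1+n (count-strict X Y X⊆Y xs u∈ yu xu)
... | false | false | here refl = ⊥-elim (true≢false yu yx)
... | false | false | there u∈ = count-strict X Y X⊆Y xs u∈ yu xu

count-pos : ∀ {n} (X : VSet n) {u} xs → u ∈ xs → X u ≡ true → 1 ≤ count X xs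
count-pos X (x ∷ xs) (here refl) xu rewrite xu = s≤s z≤n
count-pos X (x ∷ xs) (there u∈) xu with X x
... | true  = s≤s z≤n
... | false = count-pos X xs u∈ xu

count-two : ∀ {n} (X : VSet n) {u v} xs → u ∈ xs → v ∈ xs → ¬ u ≡ v →
  X u ≡ true → X v ≡ true → 2 ≤ count X xs
count-two X (x ∷ xs) (here refl) (here refl) u≢v xu xv = ⊥-elim (u≢v refl)
count-two X (x ∷ xs) (here refl) (there v∈) u≢v xu xv rewrite xu = s≤s (count-pos X xs v∈ xv)
count-two X (x ∷ xs) (there u∈) (here refl) u≢v xu xv rewrite xv = s≤s (count-pos X xs u∈ xu)
count-two X (x ∷ xs) (there u∈) (there v∈) u≢v xu xv with X x
... | true  = m≤n⇒m≤1+n (count-two X xs u∈ v∈ u≢v xu xv)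
... | false = count-two X xs u∈ v∈ u≢v xu xv

size-strict : ∀ {n} (X Y : VSet n) → (∀ u → X u ≡ true → Y u ≡ true) → ∀ u →
  Y u ≡ true → X u ≡ false → suc (size X) ≤ size Y
size-strict X Y X⊆Y u = count-strict X Y X⊆Y _ (∈-allFin u)

size-pos : ∀ {n} (X : VSet n) u → X u ≡ true → 1 ≤ size X
size-pos X u = count-pos X _ (∈-allFin u)

size-two : ∀ {n} (X : VSet n) u v → ¬ u ≡ v → X u ≡ true → X v ≡ true → 2 ≤ size X
size-two X u v = count-two X _ (∈-allFin u) (∈-allFin v)

size-≤ : ∀ {n} (X : VSet n) → size X ≤ n
size-≤ {n} X = ≤-trans (length-filter (λ v → T? (X v)) (allFin n)) (≤-reflexive (length-tabulate _))

size-two⁻ : ∀ {n} (X : VSet n) → 2 ≤ size X →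
  Σ (Fin n) λ u → Σ (Fin n) λ v → ¬ u ≡ v × X u ≡ true × X v ≡ true
size-two⁻ {n} X two = pick (filter X? (allFin n)) (Unique.filter⁺ X? (Unique.allFin⁺ n)) two member
  where
    X? = λ v → T? (X v)
    member : ∀ {u} → u ∈ filter X? (allFin n) → X u ≡ true
    member u∈ = T⇒≡ (proj₂ (∈-filter⁻ X? {xs = allFin n} u∈))
    pick : ∀ ys → Unique ys → 2 ≤ length ys → (∀ {u} → u ∈ ys → X u ≡ true) →
      Σ (Fin n) λ u → Σ (Fin n) λ v → ¬ u ≡ v × X u ≡ true × X v ≡ true
    pick (u ∷ v ∷ _) ((u≢v All.∷ _) ∷ _) _ mem = u , v , u≢v , mem (here refl) , mem (there (here refl))
    pick (_ ∷ []) _ (s≤s ()) _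

-- The balls {u | reach G S m u v} grow with m.  As long as
-- they grow strictly the m-th ball has more than m members, so since no ball
-- exceeds n some ball with index k < n is stable; after that no longer walk
-- reaches a new vertex.  Hence every walk can be replaced by one of length < n,
-- which is what makes `dist` (a search over the lengths below n) exact.

module Shortening {n : ℕ} (G : Graph n) (S : VSet n) (v : Fin n) where
  open Walks G

  ball : ℕ → VSet n
  ball m u = reach G S m u v

  Stable : ℕ → Set
  Stable k = ∀ u → ball (suc k) u ≡ true → ball k u ≡ true

  stable-or-grows : ∀ m → Stable m ⊎ Σ (Fin n) λ u → ball (suc m) u ≡ true × ball m u ≡ false
  stable-or-grows m with allV (λ u → not (ball (suc m) u) ∨ ball m u) in all-in
  ... | true  = inj₁ stable
    where
      stable : Stable m
      stable u r with ball (suc m) u | allV⁻ _ all-in u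
      ... | true | e = e
  ... | false with allV-false⁻ _ all-in
  ...   | u , e = inj₂ (u , implication-false⁻ e)

  stable-or-large : S v ≡ true → ∀ m → Σ ℕ (λ k → k < m × Stable k) ⊎ suc m ≤ size (ball m)
  stable-or-large sv zero = inj₂ (size-pos (ball 0) v (reach-refl S sv))
  stable-or-large sv (suc m) with stable-or-large sv m
  ... | inj₁ (k , k<m , st) = inj₁ (k , m≤n⇒m≤1+n k<m , st)
  ... | inj₂ large with stable-or-grows m
  ...   | inj₁ st = inj₁ (m , ≤-refl , st)
  ...   | inj₂ (u , new , old) =
    inj₂ (≤-trans (s≤s large) (size-strict (ball m) (ball (suc m)) (λ _ → reach-weaken S m) u new old))

  stable-forever : ∀ k → Stable k → ∀ j u → ball (j + k) u ≡ true → ball k u ≡ true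
  stable-forever k st zero    u r = r
  stable-forever k st (suc j) u r with reach-suc⁻ S (j + k) r
  ... | inj₁ r′ = stable-forever k st j u r′
  ... | inj₂ (w , e , r′) = st u (reach-cons S k (reach-source S (suc (j + k)) r) e (stable-forever k st j w r′))

reach-short : ∀ {n} (G : Graph n) (S : VSet n) K {u v} → reach G S K u v ≡ true →
  Σ ℕ λ j → j < n × reach G S j u v ≡ true
reach-short {n} G S K {u} {v} r with K <? n | stable-or-large (Walks.reach-target G S K r) n
  where open Shortening G S v
... | yes K<n | _           = K , K<n , r
... | no  _   | inj₂ large  = ⊥-elim (<-irrefl refl (≤-trans large (size-≤ (Shortening.ball G S v n))))
... | no  K≮n | inj₁ (k , k<n , stable) =
  k , k<n , Shortening.stable-forever G S v k stable (K ∸ k) u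
    (subst (λ m → reach G S m u v ≡ true) (sym (m∸n+n≡m (≤-trans (<⇒≤ k<n) (≮⇒≥ K≮n)))) r)

dist-reach : ∀ {n} (G : Graph n) (S : VSet n) K {u v} → reach G S K u v ≡ true →
  dist G S u v < n × reach G S (dist G S u v) u v ≡ true
dist-reach G S K r with reach-short G S K r
... | j , j<n , rj = d<n , dist-realised _ _ d<n
  where
    open Distance G S
    d<n = ≤-<-trans (dist-minimal j rj) j<n

connected-dist : ∀ {n} (G : Graph n) → Connected G → ∀ u v →
  dist G full u v < n × reach G full (dist G full u v) u v ≡ true
connected-dist G conn u v = dist-reach G full (proj₁ (conn u v)) (proj₂ (conn u v))

-- If ψ vanishes at t and drops by at most one along each
-- edge, then ψ z bounds the length of every walk from z to t from below; in a
-- connected graph, ψ z ≤ dist z t.  This is how all lower bounds on distances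
-- in G are obtained.
Lipschitz : ∀ {n} → Graph n → (Fin n → ℕ) → Set
Lipschitz G ψ = ∀ z w → adj G z w ≡ true → ψ z ≤ suc (ψ w)

potential-walk : ∀ {n} (G : Graph n) (ψ : Fin n → ℕ) t → ψ t ≡ 0 → Lipschitz G ψ →
  ∀ k z → reach G full k z t ≡ true → ψ z ≤ k
potential-walk G ψ t ψt lip zero z r with Walks.reach-zero⁻ G full r
... | refl = ≤-reflexive ψt
potential-walk G ψ t ψt lip (suc k) z r with Walks.reach-suc⁻ G full k r
... | inj₁ r′ = m≤n⇒m≤1+n (potential-walk G ψ t ψt lip k z r′)
... | inj₂ (w , e , r′) = ≤-trans (lip z w e) (s≤s (potential-walk G ψ t ψt lip k w r′))

potential-dist : ∀ {n} (G : Graph n) → Connected G → (ψ : Fin n → ℕ) → ∀ t → ψ t ≡ 0 →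
  Lipschitz G ψ → ∀ z → ψ z ≤ dist G full z t
potential-dist G conn ψ t ψt lip z =
  potential-walk G ψ t ψt lip (dist G full z t) z (proj₂ (connected-dist G conn z t))

excess : ℕ → ℕ → ℕ → ℤ
excess s₁ s₂ s₃ = + s₁ - (+ s₂ ⊔ + s₃)

cong₃ : ∀ {A B C D : Set} (f : A → B → C → D) {a a′ b b′ c c′} →
  a ≡ a′ → b ≡ b′ → c ≡ c′ → f a b c ≡ f a′ b′ c′
cong₃ f refl refl refl = refl

+-⊔ : ∀ m n → + m ⊔ + n ≡ + (m ℕ.⊔ n)
+-⊔ m n with ≤-total m n
... | inj₁ m≤n = trans (ℤP.i≤j⇒i⊔j≡j (ℤ.+≤+ m≤n)) (cong +_ (sym (m≤n⇒m⊔n≡n m≤n)))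
... | inj₂ n≤m = trans (ℤP.i≥j⇒i⊔j≡i (ℤ.+≤+ n≤m)) (cong +_ (sym (m≥n⇒m⊔n≡m n≤m)))

excess≡⊖ : ∀ s₁ s₂ s₃ → excess s₁ s₂ s₃ ≡ s₁ ⊖ (s₂ ℕ.⊔ s₃)
excess≡⊖ s₁ s₂ s₃ = trans (cong (λ m → + s₁ - m) (+-⊔ s₂ s₃)) (ℤP.[+m]-[+n]≡m⊖n s₁ (s₂ ℕ.⊔ s₃))

excess-shift : ∀ s₁ s₂ s₃ t → excess (s₁ + t) (s₂ + t) (s₃ + t) ≡ excess s₁ s₂ s₃
excess-shift s₁ s₂ s₃ t = begin
  excess (s₁ + t) (s₂ + t) (s₃ + t)   ≡⟨ excess≡⊖ (s₁ + t) (s₂ + t) (s₃ + t) ⟩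
  (s₁ + t) ⊖ ((s₂ + t) ℕ.⊔ (s₃ + t))  ≡⟨ cong ((s₁ + t) ⊖_) (sym (+-distribʳ-⊔ t s₂ s₃)) ⟩
  (s₁ + t) ⊖ (M + t)                  ≡⟨ cong₂ _⊖_ (+-comm s₁ t) (+-comm M t) ⟩
  (t + s₁) ⊖ (t + M)                  ≡⟨ ℤP.+-cancelˡ-⊖ t s₁ M ⟩
  s₁ ⊖ M                              ≡⟨ sym (excess≡⊖ s₁ s₂ s₃) ⟩
  excess s₁ s₂ s₃                     ∎
  where
    open ≡-Reasoning
    M = s₂ ℕ.⊔ s₃

M+k⊖M : ∀ M k → (M + k) ⊖ M ≡ + k
M+k⊖M M k = trans (cong ((M + k) ⊖_) (sym (+-identityʳ M))) (ℤP.+-cancelˡ-⊖ M k 0)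

excess-≤ : ∀ s₁ s₂ s₃ k → s₁ ≤ (s₂ ℕ.⊔ s₃) + k → excess s₁ s₂ s₃ ℤ.≤ + k
excess-≤ s₁ s₂ s₃ k s₁≤ = begin
  excess s₁ s₂ s₃  ≡⟨ excess≡⊖ s₁ s₂ s₃ ⟩
  s₁ ⊖ M           ≤⟨ ℤP.⊖-monoˡ-≤ M s₁≤ ⟩
  (M + k) ⊖ M      ≡⟨ M+k⊖M M k ⟩
  + k              ∎
  where
    open ℤP.≤-Reasoning
    M = s₂ ℕ.⊔ s₃

excess-≤₂ : ∀ s₁ s₂ s₃ k → s₁ ≤ s₂ + k → excess s₁ s₂ s₃ ℤ.≤ + k
excess-≤₂ s₁ s₂ s₃ k s₁≤ = excess-≤ s₁ s₂ s₃ k (≤-trans s₁≤ (+-monoˡ-≤ k (m≤m⊔n s₂ s₃)))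

excess-≤₃ : ∀ s₁ s₂ s₃ k → s₁ ≤ s₃ + k → excess s₁ s₂ s₃ ℤ.≤ + k
excess-≤₃ s₁ s₂ s₃ k s₁≤ = excess-≤ s₁ s₂ s₃ k (≤-trans s₁≤ (+-monoˡ-≤ k (m≤n⊔m s₂ s₃)))

excess-≥ : ∀ s₁ s₂ s₃ k → s₂ + k ≤ s₁ → s₃ + k ≤ s₁ → + k ℤ.≤ excess s₁ s₂ s₃
excess-≥ s₁ s₂ s₃ k s₂≤ s₃≤ = begin
  + k          ≡⟨ sym (M+k⊖M M k) ⟩
  (M + k) ⊖ M  ≤⟨ ℤP.⊖-monoˡ-≤ M (≤-trans (≤-reflexive (+-distribʳ-⊔ k s₂ s₃)) (⊔-lub s₂≤ s₃≤)) ⟩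
  s₁ ⊖ M       ≡⟨ sym (excess≡⊖ s₁ s₂ s₃) ⟩
  excess s₁ s₂ s₃ ∎
  where
    open ℤP.≤-Reasoning
    M = s₂ ℕ.⊔ s₃

excess-swap : ∀ s₁ s₂ s₃ → excess s₁ s₂ s₃ ≡ excess s₁ s₃ s₂
excess-swap s₁ s₂ s₃ = cong (λ m → + s₁ - m) (ℤP.⊔-comm (+ s₂) (+ s₃))

module FourPointSymmetry {n : ℕ} (G : Graph n) (S : VSet n) where
  open Distance G S

  fourPoint-swap : ∀ u v x y → fourPoint G S u v x y ≡ fourPoint G S u v y x
  fourPoint-swap u v x y = trans (excess-swap (d u v + d x y) (d u x + d v y) (d u y + d v x))
    (cong (λ m → excess (d u v + m) (d u y + d v x) (d u x + d v y)) (dist-sym x y))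

  fourPoint-pairs : ∀ u v x y → fourPoint G S u v x y ≡ fourPoint G S x y u v
  fourPoint-pairs u v x y = cong₃ excess (+-comm (d u v) (d x y))
    (cong₂ _+_ (dist-sym u x) (dist-sym v y))
    (trans (+-comm (d u y) (d v x)) (cong₂ _+_ (dist-sym v x) (dist-sym u y)))

foldr⊔-≥ : ∀ (z x : ℤ) xs → x ∈ xs → x ℤ.≤ foldr _⊔_ z xs
foldr⊔-≥ z x (y ∷ xs) (here refl) = ℤP.i≤i⊔j x _
foldr⊔-≥ z x (y ∷ xs) (there x∈) = ℤP.≤-trans (foldr⊔-≥ z x xs x∈) (ℤP.i≤j⊔i y _)

foldr⊔-≥-init : ∀ (z : ℤ) xs → z ℤ.≤ foldr _⊔_ z xs
foldr⊔-≥-init z [] = ℤP.≤-refl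
foldr⊔-≥-init z (y ∷ xs) = ℤP.≤-trans (foldr⊔-≥-init z xs) (ℤP.i≤j⊔i y _)

foldr⊔-≤ : ∀ (z M : ℤ) xs → (∀ x → x ∈ xs → x ℤ.≤ M) → z ℤ.≤ M → foldr _⊔_ z xs ℤ.≤ M
foldr⊔-≤ z M [] bound z≤M = z≤M
foldr⊔-≤ z M (y ∷ xs) bound z≤M =
  ℤP.⊔-lub (bound y (here refl)) (foldr⊔-≤ z M xs (λ x x∈ → bound x (there x∈)) z≤M)

module Delta2 {n : ℕ} (G : Graph n) (S : VSet n) where
  private
    S? = λ y → T? (S y)

    members : List (Fin n)
    members = filter S? (allFin n)

    values : List ℤ
    values = concatMap (λ u → concatMap (λ v → concatMap (λ x →
      map (fourPoint G S u v x) members) members) members) members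

    member⁺ : ∀ {u} → S u ≡ true → u ∈ members
    member⁺ {u} su = ∈-filter⁺ S? (∈-allFin u) (≡⇒T su)

    member⁻ : ∀ {u} → u ∈ members → S u ≡ true
    member⁻ u∈ = T⇒≡ (proj₂ (∈-filter⁻ S? {xs = allFin n} u∈))

    concatMap-∈⁻ : ∀ {A B : Set} (f : A → List B) {y} xs → y ∈ concatMap f xs →
      Σ A λ x → x ∈ xs × y ∈ f x
    concatMap-∈⁻ f xs y∈ = find (∈-concatMap⁻ f y∈)

    value⁺ : ∀ {u v x y} → S u ≡ true → S v ≡ true → S x ≡ true → S y ≡ true →
      fourPoint G S u v x y ∈ values
    value⁺ {u} {v} {x} su sv sx sy =
      ∈-concatMap⁺ _ (lose (member⁺ su) (∈-concatMap⁺ _ (lose (member⁺ sv)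
        (∈-concatMap⁺ _ (lose (member⁺ sx) (∈-map⁺ (fourPoint G S u v x) (member⁺ sy)))))))

  delta2-≥ : ∀ u v x y → S u ≡ true → S v ≡ true → S x ≡ true → S y ≡ true →
    fourPoint G S u v x y ℤ.≤ delta2 G S
  delta2-≥ u v x y su sv sx sy = foldr⊔-≥ (+ 0) _ values (value⁺ su sv sx sy)

  delta2-nonneg : + 0 ℤ.≤ delta2 G S
  delta2-nonneg = foldr⊔-≥-init (+ 0) values

  delta2-≤ : ∀ M → (∀ u v x y → S u ≡ true → S v ≡ true → S x ≡ true → S y ≡ true →
    fourPoint G S u v x y ℤ.≤ M) → + 0 ℤ.≤ M → delta2 G S ℤ.≤ M
  delta2-≤ M bound 0≤M = foldr⊔-≤ (+ 0) M values value-≤ 0≤M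
    where
      value-≤ : ∀ z → z ∈ values → z ℤ.≤ M
      value-≤ z z∈ with concatMap-∈⁻ _ members z∈
      ... | u , u∈ , z∈₁ with concatMap-∈⁻ _ members z∈₁
      ... | v , v∈ , z∈₂ with concatMap-∈⁻ _ members z∈₂
      ... | x , x∈ , z∈₃ with ∈-map⁻ (fourPoint G S u v x) z∈₃
      ... | y , y∈ , refl = bound u v x y (member⁻ u∈) (member⁻ v∈) (member⁻ x∈) (member⁻ y∈)

delta2-isometric : ∀ {n} (G : Graph n) (S T : VSet n) → (∀ x → S x ≡ true → T x ≡ true) →
  (∀ {u v} → S u ≡ true → S v ≡ true → dist G T u v ≡ dist G S u v) → delta2 G S ℤ.≤ delta2 G T
delta2-isometric G S T S⊆T iso = Delta2.delta2-≤ G S (delta2 G T) bound (Delta2.delta2-nonneg G T)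
  where
    bound : ∀ u v x y → S u ≡ true → S v ≡ true → S x ≡ true → S y ≡ true →
      fourPoint G S u v x y ℤ.≤ delta2 G T
    bound u v x y su sv sx sy = subst (ℤ._≤ delta2 G T)
      (cong₃ excess (cong₂ _+_ (iso su sv) (iso sx sy)) (cong₂ _+_ (iso su sx) (iso sv sy))
                    (cong₂ _+_ (iso su sy) (iso sv sx)))
      (Delta2.delta2-≥ G T u v x y (S⊆T u su) (S⊆T v sv) (S⊆T x sx) (S⊆T y sy))

suc-∸1 : ∀ {m} → 1 ≤ m → suc (m ∸ 1) ≡ m
suc-∸1 {suc m} _ = refl

-- Put G_P = G[P ∪ {b}], G_Q = G[Q ∪ {a}] and call depthP u = dist_{G_P}(b,u) - 1
-- the depth of u ∈ P (its distance to C), similarly depthQ.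

module SplitSide {n : ℕ} (G : Graph n) (conn : Connected G) (P Q : VSet n) (a b : Fin n)
  (Q≡¬P : ∀ v → Q v ≡ not (P v))
  (a∈C : nbhd G Q a ≡ true) (b∈D : nbhd G P b ≡ true)
  (split : ∀ c e → nbhd G Q c ≡ true → nbhd G P e ≡ true → adj G c e ≡ true) where

  open Walks G

  C D : VSet n
  C = nbhd G Q
  D = nbhd G P

  SP SQ : VSet n
  SP v = P v ∨ (v == b)
  SQ v = Q v ∨ (v == a)

  d dP dQ : Fin n → Fin n → ℕ
  d  = dist G full
  dP = dist G SP
  dQ = dist G SQ

  depthP depthQ : Fin n → ℕ
  depthP u = dP b u ∸ 1
  depthQ x = dQ a x ∸ 1

  P⇒¬Q : ∀ {v} → P v ≡ true → Q v ≡ false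
  P⇒¬Q {v} pv = trans (Q≡¬P v) (cong not pv)

  ¬P⇒Q : ∀ {v} → P v ≡ false → Q v ≡ true
  ¬P⇒Q {v} pv = trans (Q≡¬P v) (cong not pv)

  Q⇒¬P : ∀ {v} → Q v ≡ true → P v ≡ false
  Q⇒¬P {v} qv with P v in pv
  ... | true  = ⊥-elim (true≢false qv (P⇒¬Q pv))
  ... | false = refl

  ¬Q⇒P : ∀ {v} → Q v ≡ false → P v ≡ true
  ¬Q⇒P {v} qv with P v in pv
  ... | true  = refl
  ... | false = ⊥-elim (true≢false (¬P⇒Q pv) qv)

  P≢Q : ∀ {u x} → P u ≡ true → Q x ≡ true → ¬ u ≡ x
  P≢Q pu qx refl = true≢false pu (Q⇒¬P qx)

  C⊆P : ∀ {c} → C c ≡ true → P c ≡ true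
  C⊆P c∈C = ¬Q⇒P (not-true⁻ (proj₁ (∧-true⁻ c∈C)))

  D⊆Q : ∀ {e} → D e ≡ true → Q e ≡ true
  D⊆Q e∈D = ¬P⇒Q (not-true⁻ (proj₁ (∧-true⁻ e∈D)))

  P⊆SP : ∀ {v} → P v ≡ true → SP v ≡ true
  P⊆SP pv = ∨-trueˡ _ pv

  b∈SP : SP b ≡ true
  b∈SP = ∨-trueʳ (P b) (==-refl b)

  SP⁻ : ∀ {v} → SP v ≡ true → P v ≡ true ⊎ v ≡ b
  SP⁻ {v} sv with ∨-true⁻ {P v} sv
  ... | inj₁ pv = inj₁ pv
  ... | inj₂ e  = inj₂ (==-true⁻ e)

  Q⊆SQ : ∀ {v} → Q v ≡ true → SQ v ≡ true
  Q⊆SQ qv = ∨-trueˡ _ qv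

  a∈SQ : SQ a ≡ true
  a∈SQ = ∨-trueʳ (Q a) (==-refl a)

  SQ⁻ : ∀ {v} → SQ v ≡ true → Q v ≡ true ⊎ v ≡ a
  SQ⁻ {v} sv with ∨-true⁻ {Q v} sv
  ... | inj₁ qv = inj₁ qv
  ... | inj₂ e  = inj₂ (==-true⁻ e)

  crossing-edge : ∀ {z w} → P z ≡ true → Q w ≡ true → adj G z w ≡ true → C z ≡ true × D w ≡ true
  crossing-edge {z} {w} pz qw zw =
    ∧-true⁺ (cong not (P⇒¬Q pz)) (anyV⁺ (λ x → Q x ∧ adj G x z) w (∧-true⁺ qw (trans (Graph.sym G w z) zw))) ,
    ∧-true⁺ (cong not (Q⇒¬P qw)) (anyV⁺ (λ x → P x ∧ adj G x w) z (∧-true⁺ pz zw))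

  C-b : ∀ {c} → C c ≡ true → adj G c b ≡ true
  C-b c∈C = split _ b c∈C b∈D

  a-D : ∀ {e} → D e ≡ true → adj G a e ≡ true
  a-D e∈D = split a _ a∈C e∈D

  no-loop : ∀ {u} → ¬ adj G u u ≡ true
  no-loop {u} uu = true≢false uu (Graph.irrefl G u)

  -- G_P is isometric: the potential z ↦ dist_{G_P}(z, t), with the vertices of
  -- Q collapsed onto b, drops by at most one along every edge of G.
  towards : Fin n → Fin n → ℕ
  towards t z = if P z then dP z t else dP b t

  towards-lipschitz : ∀ t → Lipschitz G (towards t)
  towards-lipschitz t z w zw with P z in pz | P w in pw
  ... | true  | true  = Distance.dist-edge G SP t (P⊆SP pz) zw
  ... | true  | false = Distance.dist-edge G SP t (P⊆SP pz) (C-b (proj₁ (crossing-edge pz (¬P⇒Q pw) zw)))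
  ... | false | true  = Distance.dist-edge G SP t b∈SP
    (trans (Graph.sym G b w) (C-b (proj₁ (crossing-edge pw (¬P⇒Q pz) (trans (Graph.sym G w z) zw)))))
  ... | false | false = n≤1+n _

  towards-SP : ∀ t u → SP u ≡ true → towards t u ≡ dP u t
  towards-SP t u su with SP⁻ su
  ... | inj₁ pu rewrite pu = refl
  ... | inj₂ refl with P b
  ...   | true  = refl
  ...   | false = refl

  isometry : ∀ {u t} → SP u ≡ true → SP t ≡ true → d u t ≡ dP u t
  isometry {u} {t} su st = ≤-antisym (dist-⊆ G SP full (λ _ _ → refl) u t)
    (subst (_≤ d u t) (towards-SP t u su)
      (potential-dist G conn (towards t) t (trans (towards-SP t t st) (Distance.dist-self G SP t st))
        (towards-lipschitz t) u))

  dP-realised : ∀ {u t} → SP u ≡ true → SP t ≡ true → reach G SP (dP u t) u t ≡ true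
  dP-realised {u} {t} su st =
    Distance.dist-realised G SP u t (subst (_< n) (isometry su st) (proj₁ (connected-dist G conn u t)))

  depthP-suc : ∀ {u} → P u ≡ true → dP b u ≡ suc (depthP u)
  depthP-suc pu = sym (suc-∸1 (Distance.dist-pos G SP (P≢Q pu b∈Q ∘ sym)))
    where b∈Q = D⊆Q b∈D

  depthQ-suc : ∀ {x} → Q x ≡ true → dQ a x ≡ suc (depthQ x)
  depthQ-suc qx = sym (suc-∸1 (Distance.dist-pos G SQ (P≢Q (C⊆P a∈C) qx)))

  walk-to-C : ∀ {u} → P u ≡ true → Σ (Fin n) λ c → C c ≡ true × reach G SP (depthP u) c u ≡ true
  walk-to-C {u} pu with first-edge SP (dP b u) (dP-realised b∈SP (P⊆SP pu)) (P≢Q pu (D⊆Q b∈D) ∘ sym)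
  ... | k , c , dP≡ , bc , r with SP⁻ (reach-source SP k r)
  ...   | inj₂ refl = ⊥-elim (no-loop bc)
  ...   | inj₁ pc   = c , proj₁ (crossing-edge pc (D⊆Q b∈D) (trans (Graph.sym G c b) bc)) ,
                        subst (λ m → reach G SP m c u ≡ true) (sym (cong (_∸ 1) dP≡)) r

  near-C : ∀ {u} → P u ≡ true → Σ (Fin n) λ c → C c ≡ true × d u c ≤ depthP u
  near-C {u} pu with walk-to-C pu
  ... | c , c∈C , r = c , c∈C ,
    subst (_≤ depthP u) (Distance.dist-sym G full c u) (Distance.dist-minimal G full _ (reach-full SP (depthP u) {c} {u} r))

  -- For x ∈ Q the potential below (a crossing
  -- vertex of P costs its depth, plus one edge, plus the depth of x) drops by
  -- at most one along every edge, which gives the lower bound; a walk through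
  -- C and D gives the upper bound.
  across : Fin n → Fin n → ℕ
  across x z = if P z then suc (depthP z + depthQ x) else dQ z x

  depthP-edge : ∀ {z w} → P z ≡ true → P w ≡ true → adj G z w ≡ true → depthP z ≤ suc (depthP w)
  depthP-edge {z} {w} pz pw zw = s≤s⁻¹ (begin
    suc (depthP z) ≡⟨ sym (depthP-suc pz) ⟩
    dP b z         ≡⟨ Distance.dist-sym G SP b z ⟩
    dP z b         ≤⟨ Distance.dist-edge G SP b (P⊆SP pz) zw ⟩
    suc (dP w b)   ≡⟨ cong suc (trans (Distance.dist-sym G SP w b) (depthP-suc pw)) ⟩
    suc (suc (depthP w)) ∎)
    where open ≤-Reasoning

  depthP-C : ∀ {c} → C c ≡ true → depthP c ≡ 0
  depthP-C {c} c∈C = n≤0⇒n≡0 (s≤s⁻¹ (begin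
    suc (depthP c) ≡⟨ sym (depthP-suc (C⊆P c∈C)) ⟩
    dP b c         ≤⟨ Distance.dist-minimal G SP 1 (reach-edge SP b∈SP (P⊆SP (C⊆P c∈C)) (trans (Graph.sym G b c) (C-b c∈C))) ⟩
    1              ∎))
    where open ≤-Reasoning

  D-step : ∀ {e} x → D e ≡ true → dQ e x ≤ suc (dQ a x)
  D-step {e} x e∈D = Distance.dist-edge G SQ x (Q⊆SQ (D⊆Q e∈D)) (trans (Graph.sym G e a) (a-D e∈D))

  across-lipschitz : ∀ {x} → Q x ≡ true → Lipschitz G (across x)
  across-lipschitz {x} qx z w zw with P z in pz | P w in pw
  ... | true  | true  = s≤s (+-monoˡ-≤ (depthQ x) (depthP-edge pz pw zw))
  ... | true  | false = s≤s (begin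
      depthP z + depthQ x ≡⟨ cong (_+ depthQ x) (depthP-C (proj₁ crossing)) ⟩
      depthQ x            ≤⟨ s≤s⁻¹ (subst (_≤ suc (dQ w x)) (depthQ-suc qx)
                               (Distance.dist-edge G SQ x a∈SQ (a-D (proj₂ crossing)))) ⟩
      dQ w x              ∎)
    where
      open ≤-Reasoning
      crossing = crossing-edge pz (¬P⇒Q pw) zw
  ... | false | true  = begin
      dQ z x                      ≤⟨ D-step x (proj₂ (crossing-edge pw (¬P⇒Q pz) (trans (Graph.sym G w z) zw))) ⟩
      suc (dQ a x)                ≡⟨ cong suc (depthQ-suc qx) ⟩
      suc (suc (depthQ x))        ≤⟨ s≤s (s≤s (m≤n+m (depthQ x) (depthP w))) ⟩
      suc (suc (depthP w + depthQ x)) ∎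
    where open ≤-Reasoning
  ... | false | false = Distance.dist-edge G SQ x (Q⊆SQ (¬P⇒Q pz)) zw

  across-lower : ∀ {u x} → P u ≡ true → Q x ≡ true → suc (depthP u + depthQ x) ≤ d u x
  across-lower {u} {x} pu qx = subst (_≤ d u x) (cong (λ p → if p then suc (depthP u + depthQ x) else dQ u x) pu)
    (potential-dist G conn (across x) x across-x (across-lipschitz qx) u)
    where
      across-x : across x x ≡ 0
      across-x rewrite Q⇒¬P qx = Distance.dist-self G SQ x (Q⊆SQ qx)

  -- by the lower bound for u = a, every x ∈ Q is within reach of a in G_Q
  dQ-realised : ∀ {x} → Q x ≡ true → reach G SQ (dQ a x) a x ≡ true
  dQ-realised {x} qx = Distance.dist-realised G SQ a x (begin-strict
    dQ a x                         ≡⟨ depthQ-suc qx ⟩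
    suc (depthQ x)                 ≤⟨ s≤s (m≤n+m (depthQ x) (depthP a)) ⟩
    suc (depthP a + depthQ x)      ≤⟨ across-lower (C⊆P a∈C) qx ⟩
    d a x                          <⟨ proj₁ (connected-dist G conn a x) ⟩
    n                              ∎)
    where open ≤-Reasoning

  walk-from-D : ∀ {x} → Q x ≡ true → Σ (Fin n) λ e → D e ≡ true × reach G SQ (depthQ x) e x ≡ true
  walk-from-D {x} qx with first-edge SQ (dQ a x) (dQ-realised qx) (P≢Q (C⊆P a∈C) qx)
  ... | k , e , dQ≡ , ae , r with SQ⁻ (reach-source SQ k r)
  ...   | inj₂ refl = ⊥-elim (no-loop ae)
  ...   | inj₁ qe   = e , proj₂ (crossing-edge (C⊆P a∈C) qe ae) ,
                        subst (λ m → reach G SQ m e x ≡ true) (sym (cong (_∸ 1) dQ≡)) r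

  -- a walk from u to its nearest c ∈ C, across to e ∈ D, and on to x
  across-upper : ∀ {u x} → P u ≡ true → Q x ≡ true → d u x ≤ suc (depthP u + depthQ x)
  across-upper {u} {x} pu qx with walk-to-C pu | walk-from-D qx
  ... | c , c∈C , r₁ | e , e∈D , r₂ = subst (d u x ≤_) (+-suc (depthP u) (depthQ x))
    (Distance.dist-minimal G full _
      (reach-++ full (depthP u) (suc (depthQ x)) (reach-sym full (depthP u) (reach-full SP (depthP u) r₁))
        (reach-cons full (depthQ x) refl (split c e c∈C e∈D) (reach-full SQ (depthQ x) r₂))))

  across-distance : ∀ {u x} → P u ≡ true → Q x ≡ true → d u x ≡ suc (depthP u + depthQ x)
  across-distance pu qx = ≤-antisym (across-upper pu qx) (across-lower pu qx)

  -- Moving a vertex of Q to b shortens its distances from P by its depth in Q.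
  toP : Fin n → Fin n
  toP z = if P z then z else b

  lost : Fin n → ℕ
  lost z = if P z then 0 else depthQ z

  toP∈SP : ∀ z → SP (toP z) ≡ true
  toP∈SP z with P z in pz
  ... | true  = P⊆SP pz
  ... | false = b∈SP

  dist-from-P : ∀ {z} → P z ≡ true → ∀ w → d z w ≡ dP z (toP w) + lost w
  dist-from-P {z} pz w with P w in pw
  ... | true  = trans (isometry (P⊆SP pz) (P⊆SP pw)) (sym (+-identityʳ _))
  ... | false = trans (across-distance pz (¬P⇒Q pw))
    (cong (_+ depthQ w) (sym (trans (Distance.dist-sym G SP z b) (depthP-suc pz))))

  fourPoint-toP : ∀ {u v x} y → P u ≡ true → P v ≡ true → P x ≡ true →
    fourPoint G full u v x y ≡ fourPoint G SP u v x (toP y)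
  fourPoint-toP {u} {v} {x} y pu pv px = begin
    excess (d u v + d x y) (d u x + d v y) (d u y + d v x)
      ≡⟨ cong₃ excess (cong₂ _+_ (iso pu pv) (dist-from-P px y))
                      (cong₂ _+_ (iso pu px) (dist-from-P pv y))
                      (cong₂ _+_ (dist-from-P pu y) (iso pv px)) ⟩
    excess (dP u v + (dP x y′ + s)) (dP u x + (dP v y′ + s)) ((dP u y′ + s) + dP v x)
      ≡⟨ cong₃ excess (sym (+-assoc (dP u v) _ s)) (sym (+-assoc (dP u x) _ s)) (swap-last (dP u y′) s _) ⟩
    excess (dP u v + dP x y′ + s) (dP u x + dP v y′ + s) (dP u y′ + dP v x + s)
      ≡⟨ excess-shift (dP u v + dP x y′) (dP u x + dP v y′) (dP u y′ + dP v x) s ⟩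
    fourPoint G SP u v x y′ ∎
    where
      open ≡-Reasoning
      y′ = toP y
      s = lost y
      iso : ∀ {z w} → P z ≡ true → P w ≡ true → d z w ≡ dP z w
      iso pz pw = isometry (P⊆SP pz) (P⊆SP pw)
      swap-last : ∀ p q r → p + q + r ≡ p + r + q
      swap-last = solve-∀

  -- two points on each side, alternating: S₁ = S₃, so the excess is at most 0
  fourPoint-alternating : ∀ {u v x y} → P u ≡ true → Q v ≡ true → P x ≡ true → Q y ≡ true →
    fourPoint G full u v x y ℤ.≤ + 0
  fourPoint-alternating {u} {v} {x} {y} pu qv px qy =
    excess-≤₃ (d u v + d x y) (d u x + d v y) (d u y + d v x) 0 (≤-reflexive (begin
      d u v + d x y                       ≡⟨ cong₂ _+_ (across-distance pu qv) (across-distance px qy) ⟩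
      suc (pu′ + qv′) + suc (px′ + qy′)   ≡⟨ regroup pu′ px′ qv′ qy′ ⟩
      suc (pu′ + qy′) + suc (px′ + qv′) + 0
        ≡⟨ cong (_+ 0) (cong₂ _+_ (sym (across-distance pu qy))
             (sym (trans (Distance.dist-sym G full v x) (across-distance px qv)))) ⟩
      d u y + d v x + 0                   ∎))
    where
      open ≡-Reasoning
      pu′ = depthP u
      px′ = depthP x
      qv′ = depthQ v
      qy′ = depthQ y
      regroup : ∀ p₁ p₂ q₁ q₂ → suc (p₁ + q₁) + suc (p₂ + q₂) ≡ suc (p₁ + q₂) + suc (p₂ + q₁) + 0
      regroup = solve-∀

detour-bound : ∀ {n} (G : Graph n) {u v x y cu cv ex ey pu pv px py} k → let d = dist G full in
  d u cu ≤ pu → d v cv ≤ pv → d x ex ≤ px → d y ey ≤ py →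
  d u x ≡ suc (pu + px) → d v y ≡ suc (pv + py) → d cu cv + d ex ey ≤ 2 + k →
  fourPoint G full u v x y ℤ.≤ + k
detour-bound G {u} {v} {x} {y} {cu} {cv} {ex} {ey} {pu} {pv} {px} {py} k hu hv hx hy ux vy near =
  excess-≤₂ (d u v + d x y) (d u x + d v y) (d u y + d v x) k (begin
    d u v + d x y
      ≤⟨ +-mono-≤ (via u cu cv v) (via x ex ey y) ⟩
    (d u cu + (d cu cv + d v cv)) + (d x ex + (d ex ey + d y ey))
      ≤⟨ +-mono-≤ (+-mono-≤ hu (+-monoʳ-≤ (d cu cv) hv)) (+-mono-≤ hx (+-monoʳ-≤ (d ex ey) hy)) ⟩
    (pu + (d cu cv + pv)) + (px + (d ex ey + py))
      ≡⟨ regroup pu pv px py (d cu cv) (d ex ey) ⟩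
    (pu + px + (pv + py)) + (d cu cv + d ex ey)
      ≤⟨ +-monoʳ-≤ (pu + px + (pv + py)) near ⟩
    (pu + px + (pv + py)) + (2 + k)
      ≡⟨ regroup′ pu pv px py k ⟩
    suc (pu + px) + suc (pv + py) + k
      ≡⟨ cong₂ (λ p q → p + q + k) (sym ux) (sym vy) ⟩
    d u x + d v y + k ∎)
  where
    open ≤-Reasoning
    d = dist G full
    via : ∀ p q r s → d p s ≤ d p q + (d q r + d s r)
    via p q r s = ≤-trans (Distance.dist-triangle G full p q s) (+-monoʳ-≤ (d p q)
      (≤-trans (Distance.dist-triangle G full q r s) (≤-reflexive (cong (λ m → d q r + m) (Distance.dist-sym G full r s)))))
    regroup : ∀ pu pv px py e₁ e₂ → pu + (e₁ + pv) + (px + (e₂ + py)) ≡ pu + px + (pv + py) + (e₁ + e₂)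
    regroup = solve-∀
    regroup′ : ∀ pu pv px py k → pu + px + (pv + py) + (2 + k) ≡ suc (pu + px) + suc (pv + py) + k
    regroup′ = solve-∀

clique⁻ : ∀ {n} (G : Graph n) (X : VSet n) → isClique G X ≡ true → ∀ {u v} →
  X u ≡ true → X v ≡ true → ¬ u ≡ v → adj G u v ≡ true
clique⁻ G X clique {u} {v} xu xv u≢v =
  subst (λ t → not t ∨ adj G u v ≡ true) (∧-true⁺ xu (∧-true⁺ xv (cong not (==-false u≢v))))
    (allV⁻ _ (allV⁻ _ clique u) v)

non-clique⁻ : ∀ {n} (G : Graph n) (X : VSet n) → isClique G X ≡ false →
  Σ (Fin n) λ u → Σ (Fin n) λ v → X u ≡ true × X v ≡ true × ¬ u ≡ v × adj G u v ≡ false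
non-clique⁻ G X not-clique with allV-false⁻ _ not-clique
... | u , fails-at-u with allV-false⁻ _ fails-at-u
... | v , fails-at-uv with implication-false⁻ {X u ∧ X v ∧ not (u == v)} fails-at-uv
... | both , uv-false with ∧-true⁻ {X u} both
... | xu , rest with ∧-true⁻ {X v} rest
... | xv , u≠v = u , v , xu , xv , (λ { refl → true≢false (==-refl u) (not-true⁻ u≠v) }) , uv-false

far-apart : ∀ {n} (G : Graph n) → Connected G → ∀ {u v} → ¬ u ≡ v → adj G u v ≡ false →
  2 ≤ dist G full u v
far-apart G conn {u} {v} u≢v uv with 2 ≤? dist G full u v
... | yes 2≤d = 2≤d
... | no  2≰d with Walks.reach-one⁻ G full
                     (Walks.reach-mono G full (s≤s⁻¹ (≰⇒> 2≰d)) (proj₂ (connected-dist G conn u v)))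
...   | inj₁ u≡v = ⊥-elim (u≢v u≡v)
...   | inj₂ uv′ = ⊥-elim (true≢false uv′ uv)

-- What is known about the distance e between two members of a vertex set X
-- whose members have a common neighbour; this is all δ* depends on.
record MemberDistance {n} (G : Graph n) (X : VSet n) (e : ℕ) : Set where
  field
    at-most-two       : e ≤ 2
    clique-at-most-one : isClique G X ≡ true → e ≤ 1
    zero-or-two-members : e ≡ 0 ⊎ 2 ≤ size X

open MemberDistance

common-neighbour : ∀ {n} (G : Graph n) (X : VSet n) h → (∀ c → X c ≡ true → adj G c h ≡ true) →
  ∀ {c c′} → X c ≡ true → X c′ ≡ true → MemberDistance G X (dist G full c c′)
common-neighbour G X h X-h {c} {c′} xc xc′ = record
  { at-most-two = Distance.dist-minimal G full 2
      (reach-cons full 1 refl (X-h c xc) (reach-edge full refl refl (trans (Graph.sym G h c′) (X-h c′ xc′))))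
  ; clique-at-most-one = λ clique → case-equal
      (λ { refl → ≤-trans (≤-reflexive (Distance.dist-self G full c refl)) z≤n })
      (λ c≢c′ → Distance.dist-minimal G full 1 (reach-edge full refl refl (clique⁻ G X clique xc xc′ c≢c′)))
  ; zero-or-two-members = case-equal
      (λ { refl → inj₁ (Distance.dist-self G full c refl) })
      (λ c≢c′ → inj₂ (size-two X c c′ c≢c′ xc xc′))
  }
  where
    open Walks G
    case-equal : ∀ {R : Set} → (c ≡ c′ → R) → (¬ c ≡ c′ → R) → R
    case-equal {R} same different with c ≟ᶠ c′
    ... | yes eq  = same eq
    ... | no  neq = different neq

small-sum : ∀ {e₁ e₂ s₁ s₂} → e₁ ≤ 2 → e₂ ≤ 2 → e₁ ≡ 0 ⊎ 2 ≤ s₁ → e₂ ≡ 0 ⊎ 2 ≤ s₂ →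
  (2 ≤ᵇ s₁) ∧ (2 ≤ᵇ s₂) ≡ false → e₁ + e₂ ≤ 2
small-sum e₁≤ e₂≤ (inj₁ refl) _ _ = e₂≤
small-sum {e₁} e₁≤ e₂≤ (inj₂ _) (inj₁ refl) _ = ≤-trans (≤-reflexive (+-identityʳ e₁)) e₁≤
small-sum e₁≤ e₂≤ (inj₂ two₁) (inj₂ two₂) not-both =
  ⊥-elim (true≢false (∧-true⁺ (T⇒≡ (≤⇒≤ᵇ two₁)) (T⇒≡ (≤⇒≤ᵇ two₂))) not-both)

deltaStar-bound : ∀ {n} (G : Graph n) (C D : VSet n) {e₁ e₂} →
  MemberDistance G C e₁ → MemberDistance G D e₂ →
  Σ ℕ λ k → deltaStar2 G C D ≡ + k × e₁ + e₂ ≤ 2 + k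
deltaStar-bound G C D {e₁} {e₂} m₁ m₂ with isClique G C in cliqueC | isClique G D in cliqueD
... | false | false = 2 , refl , +-mono-≤ (at-most-two m₁) (at-most-two m₂)
... | true  | true  = 0 , refl , +-mono-≤ (clique-at-most-one m₁ cliqueC) (clique-at-most-one m₂ cliqueD)
... | true  | false with (2 ≤ᵇ size C) ∧ (2 ≤ᵇ size D) in sizes
...   | true  = 1 , refl , +-mono-≤ (clique-at-most-one m₁ cliqueC) (at-most-two m₂)
...   | false = 0 , refl , small-sum (at-most-two m₁) (at-most-two m₂)
                  (zero-or-two-members m₁) (zero-or-two-members m₂) sizes
deltaStar-bound G C D {e₁} {e₂} m₁ m₂ | false | true with (2 ≤ᵇ size C) ∧ (2 ≤ᵇ size D) in sizes
...   | true  = 1 , refl , +-mono-≤ (at-most-two m₁) (clique-at-most-one m₂ cliqueD)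
...   | false = 0 , refl , small-sum (at-most-two m₁) (at-most-two m₂)
                  (zero-or-two-members m₁) (zero-or-two-members m₂) sizes

-- Conversely δ* is attained: when C and D are completely joined, two far-apart
-- members of C and two of D form a four-point configuration with excess 2δ*.
module DeltaStarWitness {n : ℕ} (G : Graph n) (conn : Connected G) (C D : VSet n)
  (join : ∀ c e → C c ≡ true → D e ≡ true → adj G c e ≡ true) where

  open Walks G
  open Delta2 G full

  d : Fin n → Fin n → ℕ
  d = dist G full

  -- members of C and D are adjacent, so a quadruple c, c′ ∈ C, e, e′ ∈ D
  -- has S₂, S₃ ≤ 2 and excess at least d(c,c′) + d(e,e′) − 2
  joined : ∀ {c e} → C c ≡ true → D e ≡ true → d c e ≤ 1
  joined cc de = Distance.dist-minimal G full 1 (reach-edge full refl refl (join _ _ cc de))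

  spread : ∀ {c c′ e e′ k₁ k₂} k → C c ≡ true → C c′ ≡ true → D e ≡ true → D e′ ≡ true →
    k₁ ≤ d c c′ → k₂ ≤ d e e′ → k₁ + k₂ ≡ 2 + k → + k ℤ.≤ delta2 G full
  spread {c} {c′} {e} {e′} {k₁} {k₂} k cc cc′ de de′ k₁≤ k₂≤ sum =
    ℤP.≤-trans (excess-≥ (d c c′ + d e e′) (d c e + d c′ e′) (d c e′ + d c′ e) k
                  (crosses-short (joined cc de) (joined cc′ de′))
                  (crosses-short (joined cc de′) (joined cc′ de)))
               (delta2-≥ c c′ e e′ refl refl refl refl)
    where
      crosses-short : ∀ {s t} → s ≤ 1 → t ≤ 1 → s + t + k ≤ d c c′ + d e e′
      crosses-short s≤ t≤ = ≤-trans (+-monoˡ-≤ k (+-mono-≤ s≤ t≤))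
        (≤-trans (≤-reflexive (sym sum)) (+-mono-≤ k₁≤ k₂≤))

  far-pair : ∀ (X : VSet n) → isClique G X ≡ false →
    Σ (Fin n) λ u → Σ (Fin n) λ v → X u ≡ true × X v ≡ true × 2 ≤ d u v
  far-pair X not-clique =
    let u , v , xu , xv , u≢v , uv = non-clique⁻ G X not-clique
    in u , v , xu , xv , far-apart G conn u≢v uv

  near-pair : ∀ (X : VSet n) → 2 ≤ size X →
    Σ (Fin n) λ u → Σ (Fin n) λ v → X u ≡ true × X v ≡ true × 1 ≤ d u v
  near-pair X two =
    let u , v , u≢v , xu , xv = size-two⁻ X two
    in u , v , xu , xv , Distance.dist-pos G full u≢v

  witness : deltaStar2 G C D ℤ.≤ delta2 G full
  witness with isClique G C in cliqueC | isClique G D in cliqueD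
  ... | false | false =
    let c , c′ , cc , cc′ , far₁ = far-pair C cliqueC
        e , e′ , de , de′ , far₂ = far-pair D cliqueD
    in spread 2 cc cc′ de de′ far₁ far₂ refl
  ... | true | true = delta2-nonneg
  ... | true | false with (2 ≤ᵇ size C) ∧ (2 ≤ᵇ size D) in sizes
  ...   | false = delta2-nonneg
  ...   | true =
    let c , c′ , cc , cc′ , near = near-pair C (≤ᵇ⇒≤ 2 (size C) (≡⇒T (proj₁ (∧-true⁻ sizes))))
        e , e′ , de , de′ , far  = far-pair D cliqueD
    in spread 1 cc cc′ de de′ near far refl
  witness | false | true with (2 ≤ᵇ size C) ∧ (2 ≤ᵇ size D) in sizes
  ...   | false = delta2-nonneg
  ...   | true =
    let c , c′ , cc , cc′ , far  = far-pair C cliqueC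
        e , e′ , de , de′ , near = near-pair D (≤ᵇ⇒≤ 2 (size D) (≡⇒T (proj₂ (∧-true⁻ {2 ≤ᵇ size C} sizes))))
    in spread 1 cc cc′ de de′ far near refl

-- SplitSide applies to (A, B) and to (B, A).  Up to the symmetries of the
-- four-point quantity, a quadruple u, v, x, y has three points on one side
-- (its excess is one of G_A or G_B), or u, v ∈ A and x, y ∈ B (at most 2δ*,
-- by detour-bound), or alternates between the sides (at most 0).  Conversely
-- G_A and G_B are isometric subgraphs and δ* is attained.

module SplitTheorem {n : ℕ} (G : Graph n) (conn : Connected G) (A : VSet n) (spl : IsSplit G A)
  (a b : Fin n) (a∈C : nbhd G (compl A) a ≡ true) (b∈D : nbhd G A b ≡ true) where

  B C D : VSet n
  B = compl A
  C = nbhd G B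
  D = nbhd G A

  join : ∀ c e → C c ≡ true → D e ≡ true → adj G c e ≡ true
  join = proj₂ (proj₂ spl)

  module SideA = SplitSide G conn A B a b (λ _ → refl) a∈C b∈D join
  module SideB = SplitSide G conn B A b a (λ v → sym (not-involutive (A v))) b∈D a∈C
                   (λ e c e∈D c∈C → trans (Graph.sym G e c) (join c e c∈C e∈D))

  open FourPointSymmetry G full

  RHS : ℤ
  RHS = (delta2 G SideA.SP ⊔ delta2 G SideB.SP) ⊔ deltaStar2 G C D

  ≤RHS-A : ∀ {z} → z ℤ.≤ delta2 G SideA.SP → z ℤ.≤ RHS
  ≤RHS-A z≤ = ℤP.≤-trans z≤ (ℤP.≤-trans (ℤP.i≤i⊔j _ _) (ℤP.i≤i⊔j _ _))

  ≤RHS-B : ∀ {z} → z ℤ.≤ delta2 G SideB.SP → z ℤ.≤ RHS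
  ≤RHS-B z≤ = ℤP.≤-trans z≤ (ℤP.≤-trans (ℤP.i≤j⊔i _ _) (ℤP.i≤i⊔j _ _))

  ≤RHS-star : ∀ {z} → z ℤ.≤ deltaStar2 G C D → z ℤ.≤ RHS
  ≤RHS-star z≤ = ℤP.≤-trans z≤ (ℤP.i≤j⊔i _ _)

  ≤RHS-zero : ∀ {z} → z ℤ.≤ + 0 → z ℤ.≤ RHS
  ≤RHS-zero z≤ = ≤RHS-A (ℤP.≤-trans z≤ (Delta2.delta2-nonneg G SideA.SP))

  by-swap : ∀ {u v x y} → fourPoint G full u v y x ℤ.≤ RHS → fourPoint G full u v x y ℤ.≤ RHS
  by-swap {u} {v} {x} {y} = subst (ℤ._≤ RHS) (sym (fourPoint-swap u v x y))

  by-pairs : ∀ {u v x y} → fourPoint G full x y u v ℤ.≤ RHS → fourPoint G full u v x y ℤ.≤ RHS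
  by-pairs {u} {v} {x} {y} = subst (ℤ._≤ RHS) (sym (fourPoint-pairs u v x y))

  three-in-A : ∀ {u v x} y → A u ≡ true → A v ≡ true → A x ≡ true → fourPoint G full u v x y ℤ.≤ RHS
  three-in-A {u} {v} {x} y au av ax = ≤RHS-A (subst (ℤ._≤ delta2 G SideA.SP)
    (sym (SideA.fourPoint-toP y au av ax))
    (Delta2.delta2-≥ G SideA.SP u v x (SideA.toP y)
      (SideA.P⊆SP au) (SideA.P⊆SP av) (SideA.P⊆SP ax) (SideA.toP∈SP y)))

  three-in-B : ∀ {u v x} y → A u ≡ false → A v ≡ false → A x ≡ false → fourPoint G full u v x y ℤ.≤ RHS
  three-in-B {u} {v} {x} y au av ax = ≤RHS-B (subst (ℤ._≤ delta2 G SideB.SP)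
    (sym (SideB.fourPoint-toP y (cong not au) (cong not av) (cong not ax)))
    (Delta2.delta2-≥ G SideB.SP u v x (SideB.toP y)
      (SideB.P⊆SP (cong not au)) (SideB.P⊆SP (cong not av)) (SideB.P⊆SP (cong not ax)) (SideB.toP∈SP y)))

  alternating-A : ∀ {u v x y} → A u ≡ true → A v ≡ false → A x ≡ true → A y ≡ false →
    fourPoint G full u v x y ℤ.≤ RHS
  alternating-A au av ax ay = ≤RHS-zero (SideA.fourPoint-alternating au (cong not av) ax (cong not ay))

  alternating-B : ∀ {u v x y} → A u ≡ false → A v ≡ true → A x ≡ false → A y ≡ true →
    fourPoint G full u v x y ℤ.≤ RHS
  alternating-B au av ax ay = ≤RHS-zero (SideB.fourPoint-alternating (cong not au) av (cong not ax) ay)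

  -- u, v ∈ A and x, y ∈ B: route through the nearest vertices of C and of D
  pairs-apart : ∀ {u v x y} → A u ≡ true → A v ≡ true → A x ≡ false → A y ≡ false →
    fourPoint G full u v x y ℤ.≤ RHS
  pairs-apart au av ax ay
    with SideA.near-C au | SideA.near-C av | SideB.near-C (cong not ax) | SideB.near-C (cong not ay)
  ... | cu , cu∈C , hu | cv , cv∈C , hv | ex , ex∈D , hx | ey , ey∈D , hy
    with deltaStar-bound G C D (common-neighbour G C b (λ c → SideA.C-b) cu∈C cv∈C)
                               (common-neighbour G D a (λ e → SideB.C-b) ex∈D ey∈D)
  ... | k , δ*≡k , near = ≤RHS-star (subst (_ ℤ.≤_) (sym δ*≡k)
    (detour-bound G k hu hv hx hy (SideA.across-distance au (cong not ax))
      (SideA.across-distance av (cong not ay)) near))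

  bound : ∀ u v x y → fourPoint G full u v x y ℤ.≤ RHS
  bound u v x y with A u in au | A v in av | A x in ax | A y in ay
  ... | true  | true  | true  | _     = three-in-A y au av ax
  ... | true  | true  | false | true  = by-swap (three-in-A x au av ay)
  ... | true  | false | true  | true  = by-pairs (three-in-A v ax ay au)
  ... | false | true  | true  | true  = by-pairs (by-swap (three-in-A u ax ay av))
  ... | false | false | false | _     = three-in-B y au av ax
  ... | false | false | true  | false = by-swap (three-in-B x au av ay)
  ... | false | true  | false | false = by-pairs (three-in-B v ax ay au)
  ... | true  | false | false | false = by-pairs (by-swap (three-in-B u ax ay av))
  ... | true  | true  | false | false = pairs-apart au av ax ay
  ... | false | false | true  | true  = by-pairs (pairs-apart ax ay au av)
  ... | true  | false | true  | false = alternating-A au av ax ay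
  ... | true  | false | false | true  = by-swap (alternating-A au av ay ax)
  ... | false | true  | false | true  = alternating-B au av ax ay
  ... | false | true  | true  | false = by-swap (alternating-B au av ay ax)

lemma8 : ∀ {n} (G : Graph n) → Connected G → (A : VSet n) → IsSplit G A →
    (a b : Fin n) → nbhd G (compl A) a ≡ true → nbhd G A b ≡ true →
    delta2 G full ≡
      (delta2 G (λ v → A v ∨ (v == b)) ⊔ delta2 G (λ v → compl A v ∨ (v == a)))
        ⊔ deltaStar2 G (nbhd G (compl A)) (nbhd G A)
lemma8 G conn A split a b a∈C b∈D = ℤP.≤-antisym
  (Delta2.delta2-≤ G full RHS (λ u v x y _ _ _ _ → bound u v x y) (≤RHS-zero ℤP.≤-refl))
  (ℤP.⊔-lub
    (ℤP.⊔-lub (delta2-isometric G SideA.SP full (λ _ _ → refl) SideA.isometry)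
              (delta2-isometric G SideB.SP full (λ _ _ → refl) SideB.isometry))
    (DeltaStarWitness.witness G conn (nbhd G (compl A)) (nbhd G A) join))
  where open SplitTheorem G conn A split a b a∈C b∈D
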